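{- There is no deterministic online algorithm with competitive ratio $o(n)$ for the degree-bounded group Steiner tree problem, where $n$ is the number of vertices. That is, for every deterministic online algorithm $\mathcal{A}$ and every function $f$ with $f(n)=o(n)$, there exist an instance on some number $n$ of vertices and a sequence of demand groups such that the maximum degree of $\mathcal{A}$'s final subgraph exceeds $f(n)\cdot\mathrm{OPT}$.
   Context: Online degree-bounded group Steiner tree: an undirected graph $G$ with a root vertex is given in advance; demands are subsets (groups) of vertices arriving one by one, and after each arrival the online algorithm must add edges (never removing any) so that for every group seen so far, at least one vertex of the group is connected to the root. The objective is to minimize the maximum vertex degree of the final subgraph; $\mathrm{OPT}$ is the minimum maximum degree of a subgraph in which every demand group has a vertex connected to the root. The competitive ratio is the worst-case ratio of the algorithm's maximum degree to $\mathrm{OPT}$. -}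

module Defs where

open import Data.Fin using (Fin)
open import Data.Fin.Subset using (Subset; _∈_; _∉_; _⊆_; ∣_∣; Empty)
open import Data.Integer using (+_)
open import Data.List using (List; []; _∷_; tabulate)
open import Data.List.Extrema.Nat using (max)
open import Data.List.Relation.Unary.All using (All)
open import Data.Nat as ℕ using (ℕ)
open import Data.Product using (∃; _×_)
open import Data.Rational as ℚ using (ℚ; 0ℚ; _/_)
open import Relation.Binary.Construct.Closure.ReflexiveTransitive using (Star)
open import Relation.Binary.PropositionalEquality using (_≡_)

-- Finite simple undirected graphs on the vertex set Fin n.
record Graph (n : ℕ) : Set where
  field
    neighbours : Fin n → Subset n
    symmetric  : ∀ {u v} → v ∈ neighbours u → u ∈ neighbours v
    loopless   : ∀ {v} → v ∉ neighbours v

open Graph public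

degree : ∀ {n} → Graph n → Fin n → ℕ
degree G v = ∣ neighbours G v ∣

maxDegree : ∀ {n} → Graph n → ℕ
maxDegree G = max 0 (tabulate (degree G))

-- Subgraphs are taken to be spanning (isolated vertices change neither degrees
-- nor connections to the root), so a subgraph is just a set of edges.
_⊑_ : ∀ {n} → Graph n → Graph n → Set
H ⊑ G = ∀ v → neighbours H v ⊆ neighbours G v

Edgeless : ∀ {n} → Graph n → Set
Edgeless H = ∀ v → Empty (neighbours H v)

Connected : ∀ {n} → Graph n → Fin n → Fin n → Set
Connected G = Star (λ u v → v ∈ neighbours G u)

record RootedGraph (n : ℕ) : Set where
  field
    graph : Graph n
    root  : Fin n

open RootedGraph public

-- A sequence of demand groups, the most recently arrived group first.
Demands : ℕ → Set
Demands n = List (Subset n)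

Serves : ∀ {n} → Graph n → Fin n → Demands n → Set
Serves H r = All (λ g → ∃ λ v → v ∈ g × Connected H r v)

IsSolution : ∀ {n} → RootedGraph n → Demands n → Graph n → Set
IsSolution I gs H = H ⊑ graph I × Serves H (root I) gs

-- Demands that can be met at all, i.e. by buying every edge.
Feasible : ∀ {n} → RootedGraph n → Demands n → Set
Feasible I gs = Serves (graph I) (root I) gs

record IsOPT {n : ℕ} (I : RootedGraph n) (gs : Demands n) (opt : ℕ) : Set where
  field
    attained : ∃ λ H → IsSolution I gs H × maxDegree H ≡ opt
    minimal  : ∀ H → IsSolution I gs H → opt ℕ.≤ maxDegree H

-- A deterministic online algorithm: its current subgraph is a function of the
-- rooted graph (known in advance) and the groups that have arrived so far.
-- Nothing is asked of it on demand sequences that no subgraph can serve.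
record OnlineAlgorithm : Set where
  field
    output   : ∀ {n} → RootedGraph n → Demands n → Graph n
    start    : ∀ {n} (I : RootedGraph n) → Edgeless (output I [])
    monotone : ∀ {n} (I : RootedGraph n) g gs → Feasible I (g ∷ gs) →
               output I gs ⊑ output I (g ∷ gs)
    correct  : ∀ {n} (I : RootedGraph n) gs → Feasible I gs →
               IsSolution I gs (output I gs)

open OnlineAlgorithm public

fromℕ : ℕ → ℚ
fromℕ k = + k / 1

-- f(n) = o(n)
Sublinear : (ℕ → ℚ) → Set
Sublinear f = ∀ ε → 0ℚ ℚ.< ε →
  ∃ λ N → ∀ n → N ℕ.≤ n → ℚ.∣ f n ∣ ℚ.≤ ε ℚ.* fromℕ n

{-# OPTIONS --safe #-}

-- On a star rooted at its centre the adversary keeps demanding the group of all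
-- leaves not yet joined to the root.  Each demand forces a new edge at the root,
-- so the algorithm ends up buying the whole star.  The demanded groups are nested,
-- so a single edge to a leaf of the last group serves them all and OPT = 1.
module Submission where

open import Data.Bool using (true; false)
open import Data.Empty using (⊥-elim)
open import Data.Fin using (Fin; zero; suc)
open import Data.Fin.Subset
  using (Subset; _∈_; _⊆_; _⊂_; Nonempty; Empty; inside; outside; ∁; ⁅_⁆; ⊥; ⊤)
  renaming (∣_∣ to size)
open import Data.Fin.Subset.Induction using (Acc; acc; ⊂-wellFounded)
open import Data.Fin.Subset.Properties
  using (∉⊥; ∈⊤; x∈⁅x⁆; x∈⁅y⁆⇒x≡y; ∣⁅x⁆∣≡1; ∣⊤∣≡n; ∣⊥∣≡0; nonempty?;
    p⊆q⇒∣p∣≤∣q∣; p⊆q⇒∁p⊇∁q; x∉∁p⇒x∈p; x∈p⇒x∉∁p; x∉p⇒x∈∁p)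
import Data.Integer as ℤ
import Data.Integer.Properties as ℤP
open import Data.List using ([]; _∷_)
open import Data.List.Extrema.Nat using (max≤v⁺; xs≤max)
open import Data.List.Relation.Unary.All as All using (All; []; _∷_)
import Data.List.Relation.Unary.All.Properties as AllP
open import Data.Nat as ℕ using (ℕ; suc; z≤n; s≤s)
import Data.Nat.Properties as ℕP
open import Data.Product using (Σ-syntax; ∃; _×_; _,_; proj₁; proj₂)
open import Data.Rational using (ℚ; _*_; _<_; _≤_; 0ℚ; ½; ∣_∣; toℚᵘ)
import Data.Rational.Properties as ℚP
open import Data.Rational.Unnormalised as ℚᵘ using (mkℚᵘ)
import Data.Rational.Unnormalised.Properties as ℚᵘP
open import Data.Sum using (_⊎_; inj₁; inj₂)
open import Data.Vec using (tail; lookup; _∷_; here; there)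
open import Data.Vec.Properties using ([]=⇒lookup; lookup⇒[]=)
open import Relation.Binary.Construct.Closure.ReflexiveTransitive using (ε; _◅_)
open import Relation.Binary.PropositionalEquality using (_≡_; refl; sym; trans; subst; subst₂)
open import Relation.Nullary using (yes; no)
open import Defs

suc∈⇒∈tail : ∀ {n} {v : Fin n} {p} → suc v ∈ p → v ∈ tail p
suc∈⇒∈tail (there v∈p) = v∈p

∈tail⇒suc∈ : ∀ {n} {v : Fin n} {p} → v ∈ tail p → suc v ∈ p
∈tail⇒suc∈ {p = _ ∷ _} v∈p = there v∈p

degree≤maxDegree : ∀ {n} (G : Graph n) v → degree G v ℕ.≤ maxDegree G
degree≤maxDegree G = AllP.tabulate⁻ (xs≤max 0 _)

maxDegree≤ : ∀ {n k} (G : Graph n) → (∀ v → degree G v ℕ.≤ k) → maxDegree G ℕ.≤ k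
maxDegree≤ G bound = max≤v⁺ z≤n (AllP.tabulate⁺ bound)

-- Leaves outside `S` remain as isolated vertices, so one definition gives both the host graph (`S`
-- = `⊤`) and an optimal solution (`S` a singleton).
star : ∀ {m} → Subset m → Graph (suc m)
star S .neighbours zero    = outside ∷ S
star S .neighbours (suc i) = lookup S i ∷ ⊥
star S .symmetric {zero}  {suc v} (there v∈S) =
  subst (λ s → zero ∈ s ∷ ⊥) (sym ([]=⇒lookup v∈S)) here
star S .symmetric {suc u} {zero}  0∈N = there (lookup⇒[]= u S (head-inside 0∈N))
  where
  head-inside : ∀ {n s} {p : Subset n} → zero ∈ s ∷ p → s ≡ inside
  head-inside here = refl
star S .symmetric {suc u} {suc v} (there v∈⊥) = ⊥-elim (∉⊥ v∈⊥)
star S .loopless {suc v} (there v∈⊥) = ∉⊥ v∈⊥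

star-mono : ∀ {m} {S T : Subset m} → S ⊆ T → star S ⊑ star T
star-mono S⊆T zero (there x∈S) = there (S⊆T x∈S)
star-mono {S = S} {T} S⊆T (suc u) {zero} u∈N =
  star T .symmetric {zero} {suc u} (there (S⊆T (suc∈⇒∈tail (star S .symmetric {suc u} u∈N))))
star-mono S⊆T (suc u) {suc v} (there v∈⊥) = ⊥-elim (∉⊥ v∈⊥)

maxDegree-star-⁅⁆ : ∀ {m} (v : Fin m) → maxDegree (star ⁅ v ⁆) ℕ.≤ 1
maxDegree-star-⁅⁆ {m} v = maxDegree≤ (star ⁅ v ⁆) bound
  where
  bound : ∀ u → degree (star ⁅ v ⁆) u ℕ.≤ 1
  bound zero = ℕP.≤-reflexive (∣⁅x⁆∣≡1 v)
  bound (suc u) with lookup ⁅ v ⁆ u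
  ... | true  = s≤s (ℕP.≤-reflexive (∣⊥∣≡0 m))
  ... | false = ℕP.≤-trans (ℕP.≤-reflexive (∣⊥∣≡0 m)) z≤n

starInstance : ∀ m → RootedGraph (suc m)
starInstance m .graph = star ⊤
starInstance m .root  = zero

joined : ∀ {m} → Graph (suc m) → Subset m
joined H = tail (neighbours H zero)

missed : ∀ {m} → Graph (suc m) → Subset m
missed H = ∁ (joined H)

-- In a subgraph of the star a leaf can have no neighbour but the centre, so the last edge of a path
-- from the centre to a leaf leaves the centre.
connected⇒joined : ∀ {m} (H : Graph (suc m)) → H ⊑ star ⊤ →
  ∀ {v} → Connected H zero (suc v) → v ∈ joined H
connected⇒joined H H⊑ path with from path
  where
  -- Recursion strips the first edge, so the start is generalised. The left alternative marks a path
  -- already at its target: the edge before it then ends at the leaf and must come from the centre.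
  from : ∀ {u v} → Connected H u (suc v) → u ≡ suc v ⊎ v ∈ joined H
  from ε = inj₁ refl
  from (e ◅ p) with from p
  from (e ◅ p)         | inj₂ v∈J = inj₂ v∈J
  from {zero}  (e ◅ p) | inj₁ refl = inj₂ (suc∈⇒∈tail e)
  from {suc u} (e ◅ p) | inj₁ refl = ⊥-elim (∉⊥ (suc∈⇒∈tail (H⊑ (suc u) e)))
... | inj₂ v∈J = v∈J

-- The adversary's invariant, with `S` the leaves still missed: connecting any single leaf of `S`
-- serves every group so far.
CommonLeaves : ∀ {m} → Subset m → Demands (suc m) → Set
CommonLeaves S = All (λ g → outside ∷ S ⊆ g)

-- Used with `T` = `⊤` for feasibility and with `T` = `⁅ v ⁆` for the upper bound on OPT.
serves-star : ∀ {m} {S T : Subset m} {v} {gs} → v ∈ S → v ∈ T →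
  CommonLeaves S gs → Serves (star T) zero gs
serves-star {v = v} v∈S v∈T =
  All.map (λ S⊆g → suc v , S⊆g (there v∈S) , there v∈T ◅ ε)

-- The newest group omits the root, so serving it takes a path to a leaf, hence an edge at the
-- centre.
1≤maxDegree : ∀ {m} {S : Subset m} {gs} (H : Graph (suc m)) → H ⊑ star ⊤ →
  Serves H zero ((outside ∷ S) ∷ gs) → 1 ℕ.≤ maxDegree H
1≤maxDegree H H⊑ ((suc v , _ , path) ∷ _) = begin
  1                           ≡⟨ ∣⁅x⁆∣≡1 (suc v) ⟨
  size ⁅ suc v ⁆              ≤⟨ p⊆q⇒∣p∣≤∣q∣ ⁅v⁆⊆N ⟩
  degree H zero               ≤⟨ degree≤maxDegree H zero ⟩
  maxDegree H                 ∎
  where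
  open ℕP.≤-Reasoning
  ⁅v⁆⊆N : ⁅ suc v ⁆ ⊆ neighbours H zero
  ⁅v⁆⊆N x∈ rewrite x∈⁅y⁆⇒x≡y _ x∈ =
    ∈tail⇒suc∈ (connected⇒joined H H⊑ path)

isOPT-one : ∀ {m} {S : Subset m} {gs} → Nonempty S →
  CommonLeaves S ((outside ∷ S) ∷ gs) → IsOPT (starInstance m) ((outside ∷ S) ∷ gs) 1
isOPT-one (v , v∈S) common = record
  { attained = star ⁅ v ⁆ , edge-solves
             , ℕP.≤-antisym (maxDegree-star-⁅⁆ v) (lower (star ⁅ v ⁆) edge-solves)
  ; minimal  = lower
  }
  where
  edge-solves = star-mono (λ _ → ∈⊤) , serves-star v∈S (x∈⁅x⁆ v) common
  lower = λ H sol → 1≤maxDegree H (proj₁ sol) (proj₂ sol)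

¬missed⇒maxDegree : ∀ {m} (H : Graph (suc m)) → Empty (missed H) → m ℕ.≤ maxDegree H
¬missed⇒maxDegree {m} H empty = begin
  m                             ≡⟨ ∣⊤∣≡n m ⟨
  degree (star (⊤ {m})) zero    ≤⟨ p⊆q⇒∣p∣≤∣q∣ ⊤⊆N ⟩
  degree H zero                 ≤⟨ degree≤maxDegree H zero ⟩
  maxDegree H                   ∎
  where
  open ℕP.≤-Reasoning
  ⊤⊆N : outside ∷ ⊤ ⊆ neighbours H zero
  ⊤⊆N (there _) = ∈tail⇒suc∈ (x∉∁p⇒x∈p (λ v∈ → empty (_ , v∈)))

module Adversary (A : OnlineAlgorithm) (m : ℕ) where

  missedAfter : Demands (suc m) → Subset m
  missedAfter gs = missed (output A (starInstance m) gs)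

  -- The entry `outside` keeps the root out of the group; otherwise the demand would be served for
  -- free.
  next : Demands (suc m) → Demands (suc m)
  next gs = (outside ∷ missedAfter gs) ∷ gs

  module _ {gs} (ne : Nonempty (missedAfter gs))
           (common : CommonLeaves (missedAfter gs) gs) where

    next-common : CommonLeaves (missedAfter gs) (next gs)
    next-common = (λ x → x) ∷ common

    next-feasible : Feasible (starInstance m) (next gs)
    next-feasible = serves-star (proj₂ ne) ∈⊤ next-common

    -- Monotonicity keeps joined leaves joined, which gives the inclusion. Correctness connects some
    -- `w` of the new group, a leaf missed until now, which makes it strict.
    missed-shrinks : missedAfter (next gs) ⊂ missedAfter gs
    missed-shrinks with correct A (starInstance m) (next gs) next-feasible
    ... | H⊑ , (suc w , there w∈missed , path) ∷ _ =
      p⊆q⇒∁p⊇∁q (λ x∈J → suc∈⇒∈tail (keeps (∈tail⇒suc∈ x∈J))) ,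
      w , w∈missed , x∈p⇒x∉∁p (connected⇒joined (output A (starInstance m) (next gs)) H⊑ path)
      where keeps = monotone A (starInstance m) _ gs next-feasible zero

  Bad : Demands (suc m) → Set
  Bad gs = Feasible (starInstance m) gs × IsOPT (starInstance m) gs 1 ×
           m ℕ.≤ maxDegree (output A (starInstance m) gs)

  play : ∀ gs → Acc _⊂_ (missedAfter gs) → Nonempty (missedAfter gs) →
    CommonLeaves (missedAfter gs) gs → ∃ Bad
  play gs (acc rec) ne common with nonempty? (missedAfter (next gs))
  ... | yes ne′ = play (next gs) (rec shrinks) ne′
        -- Groups that contain the old missed set also contain the smaller new one, so the invariant
        -- survives.
        (All.map (λ S⊆g → λ { (there x∈) → S⊆g (there (proj₁ shrinks x∈)) })
                 (next-common ne common))
    where shrinks = missed-shrinks ne common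
  -- OPT is certified by `ne` and `common` from before the last demand: a leaf of the last group is
  -- the witness, although no leaf is missed any more.
  ... | no empty = next gs , next-feasible ne common , isOPT-one ne (next-common ne common) ,
        ¬missed⇒maxDegree (output A (starInstance m) (next gs)) empty

  bad-demands : Fin m → ∃ Bad
  bad-demands v = play [] (⊂-wellFounded _) (v , x∉p⇒x∈∁p v∉joined) []
    where
    v∉joined = λ v∈J → start A (starInstance m) zero (suc v , ∈tail⇒suc∈ v∈J)

p≤∣p∣ : ∀ p → p ≤ ∣ p ∣
p≤∣p∣ p with ℚP.≤-total 0ℚ p
... | inj₁ 0≤p = ℚP.≤-reflexive (sym (ℚP.0≤p⇒∣p∣≡p 0≤p))
... | inj₂ p≤0 = ℚP.≤-trans p≤0 (ℚP.0≤∣p∣ p)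

-- `fromℕ` reduces to lowest terms and does not compute on a variable. In unnormalised rationals,
-- comparisons become integer cross-multiplications.
toℚᵘ-fromℕ : ∀ k → toℚᵘ (fromℕ k) ℚᵘ.≃ mkℚᵘ (ℤ.+ k) 0
toℚᵘ-fromℕ k = ℚP.toℚᵘ-fromℚᵘ (mkℚᵘ (ℤ.+ k) 0)

half-< : ∀ {j k} → j ℕ.< k ℕ.* 2 → ½ * fromℕ j < fromℕ k
half-< {j} {k} j<2k = ℚP.toℚᵘ-cancel-< (begin-strict
  toℚᵘ (½ * fromℕ j)       ≃⟨ ℚP.toℚᵘ-homo-* ½ (fromℕ j) ⟩
  toℚᵘ ½ ℚᵘ.* toℚᵘ (fromℕ j) ≃⟨ ℚᵘP.*-congˡ {toℚᵘ ½} (toℚᵘ-fromℕ j) ⟩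
  toℚᵘ ½ ℚᵘ.* mkℚᵘ (ℤ.+ j) 0   <⟨ ℚᵘ.*<* lt ⟩
  mkℚᵘ (ℤ.+ k) 0                         ≃⟨ toℚᵘ-fromℕ k ⟨
  toℚᵘ (fromℕ k)           ∎)
  where
  open ℚᵘP.≤-Reasoning
  lt : (ℤ.+ 1 ℤ.* ℤ.+ j) ℤ.* ℤ.+ 1 ℤ.< ℤ.+ k ℤ.* ℤ.+ 2
  lt = subst₂ ℤ._<_ (sym (trans (ℤP.*-identityʳ _) (ℤP.*-identityˡ _))) (ℤP.pos-* k 2) (ℤ.+<+ j<2k)

fromℕ-mono-≤ : ∀ {j k} → j ℕ.≤ k → fromℕ j ≤ fromℕ k
fromℕ-mono-≤ {j} {k} j≤k = ℚP.toℚᵘ-cancel-≤ (begin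
  toℚᵘ (fromℕ j) ≃⟨ toℚᵘ-fromℕ j ⟩
  mkℚᵘ (ℤ.+ j) 0 ≤⟨ ℚᵘ.*≤* (ℤP.*-monoʳ-≤-nonNeg (ℤ.+ 1) (ℤ.+≤+ j≤k)) ⟩
  mkℚᵘ (ℤ.+ k) 0 ≃⟨ toℚᵘ-fromℕ k ⟨
  toℚᵘ (fromℕ k) ∎)
  where open ℚᵘP.≤-Reasoning

below-half⇒< : ∀ q n m d → ∣ q ∣ ≤ ½ * fromℕ n → n ℕ.< m ℕ.* 2 → m ℕ.≤ d →
  q * fromℕ 1 < fromℕ d
below-half⇒< q n m d ∣q∣≤n/2 n<2m m≤d = begin-strict
  q * fromℕ 1  ≡⟨ ℚP.*-identityʳ q ⟩
  -- The values of `f` may be negative, while `Sublinear` bounds their absolute value.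
  q            ≤⟨ p≤∣p∣ q ⟩
  ∣ q ∣        ≤⟨ ∣q∣≤n/2 ⟩
  ½ * fromℕ n  <⟨ half-< {n} {m} n<2m ⟩
  fromℕ m      ≤⟨ fromℕ-mono-≤ {m} {d} m≤d ⟩
  fromℕ d      ∎
  where open ℚP.≤-Reasoning

star-defeats : ∀ (A : OnlineAlgorithm) (f : ℕ → ℚ) m → Fin m →
  ∣ f (suc m) ∣ ≤ ½ * fromℕ (suc m) → suc m ℕ.< m ℕ.* 2 →
  Σ[ n ∈ ℕ ] Σ[ I ∈ RootedGraph n ] Σ[ gs ∈ Demands n ] Σ[ opt ∈ ℕ ]
    Feasible I gs × IsOPT I gs opt ×
    f n * fromℕ opt < fromℕ (maxDegree (output A I gs))
star-defeats A f m v ∣fn∣≤n/2 n<2m =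
  let gs , feasible , isOPT , m≤maxDegree = Adversary.bad-demands A m v
  in suc m , starInstance m , gs , 1 , feasible , isOPT ,
     below-half⇒< (f (suc m)) (suc m) m (maxDegree (output A (starInstance m) gs))
       ∣fn∣≤n/2 n<2m m≤maxDegree

theorem4 : (A : OnlineAlgorithm) (f : ℕ → ℚ) → Sublinear f →
    Σ[ n ∈ ℕ ] Σ[ I ∈ RootedGraph n ] Σ[ gs ∈ Demands n ] Σ[ opt ∈ ℕ ]
    Feasible I gs × IsOPT I gs opt ×
    f n * fromℕ opt < fromℕ (maxDegree (output A I gs))
theorem4 A f sublinear =
  -- The algorithm is driven to degree at least n - 1, which exceeds n/2 for n at least 3; hence the
  -- choice of ½.
  let N , bound = sublinear ½ (ℚP.positive⁻¹ ½)
      -- Then n = `suc m` = 3 + `N` is at least `N`, and n < 2m amounts to 4 + `N` ≤ 4 + 2`N`.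
      m = 2 ℕ.+ N
  in star-defeats A f m zero (bound (suc m) (ℕP.m≤n+m N 3))
       (s≤s (s≤s (s≤s (s≤s (ℕP.m≤m*n N 2)))))
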